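{- Let $G=(V,E)$ be the hexagonal lattice, i.e. the infinite 3-regular simple graph of vertices and edges of the tiling of the Euclidean plane by regular hexagons. Then $K_2(x,y)\ge0$ for all $x,y\in V$ with $d(x,y)\le2$.
   Context: $d(x,y)$ is the combinatorial (path) distance. $\Delta f(x)=\sum_{y\sim x}(f(y)-f(x))$. For an integer $R\ge1$, $|\nabla_R f|(x)=\max_{d(x,y)\le R}|f(y)-f(x)|$, and the Gradient-Ollivier curvature is $$K_R(x,y)=\inf\big\{\Delta|\nabla_R f|(x)-(\Delta f(y)-\Delta f(x))\,\mathrm{sgn}(f(y)-f(x))\big\},$$ over all $f:V\to\mathbb{R}$ with $|\nabla_Rf|(x)=1$ and $|f(y)-f(x)|=|\nabla_R f|(x)$ (with $\inf\emptyset=+\infty$). The corollary concerns $R=2$. -}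

module Defs where

open import Data.Integer as ℤ using (ℤ)
import Data.Integer.Properties as ℤₚ
open import Data.List using (List; []; _∷_; _++_; map; foldr; concatMap)
open import Data.List.Membership.Propositional using (_∈_; _∉_; lose; find)
open import Data.List.Membership.Propositional.Properties
  using (∈-++⁺ˡ; ∈-++⁺ʳ; ∈-++⁻; ∈-concatMap⁺; ∈-concatMap⁻)
import Data.List.Membership.DecPropositional as DecMembership
open import Data.List.Relation.Unary.All using ([]; _∷_)
open import Data.List.Relation.Unary.AllPairs using ([]; _∷_)
open import Data.List.Relation.Unary.Any using (here; there)
open import Data.List.Relation.Unary.Unique.Propositional using (Unique)
open import Data.Nat as ℕ using (ℕ; zero; suc; z≤n; s≤s)
import Data.Nat.Properties as ℕₚ
open import Data.Product using (∃; ∃-syntax; _×_; _,_; proj₁; proj₂)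
open import Data.Rational as ℚ using (ℚ; 0ℚ; 1ℚ; ½; Positive)
import Data.Rational.Properties as ℚₚ
open import Data.Rational.Solver using (module +-*-Solver)
open import Data.Sum using (inj₁; inj₂; [_,_]′)
open import Data.Unit using (⊤)
open import Function using (_∘_)
open import Function.Bundles using (_⇔_; mk⇔)
open import Relation.Binary using (DecidableEquality)
open import Relation.Binary.PropositionalEquality
  using (_≡_; _≢_; refl; sym; trans; cong; subst; subst₂)
open import Relation.Nullary using (yes; no)

module ℚ-estimates where

  half>0 : ∀ {ε} → 0ℚ ℚ.< ε → 0ℚ ℚ.< ½ ℚ.* ε
  half>0 {ε} 0<ε =
    subst (ℚ._< ½ ℚ.* ε) (ℚₚ.*-zeroʳ ½) (ℚₚ.*-monoʳ-<-pos ½ 0<ε)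

  halves : ∀ ε → ½ ℚ.* ε ℚ.+ ½ ℚ.* ε ≡ ε
  halves ε = trans (sym (ℚₚ.*-distribʳ-+ ε ½ ½)) (ℚₚ.*-identityˡ ε)

  p≤∣p∣ : ∀ p → p ℚ.≤ ℚ.∣ p ∣
  p≤∣p∣ p with ℚₚ.≤-total 0ℚ p
  ... | inj₁ 0≤p = ℚₚ.≤-reflexive (sym (ℚₚ.0≤p⇒∣p∣≡p 0≤p))
  ... | inj₂ p≤0 = ℚₚ.≤-trans p≤0 (ℚₚ.0≤∣p∣ p)

  ∣∣-lub : ∀ p {ε} → p ℚ.≤ ε → ℚ.- p ℚ.≤ ε → ℚ.∣ p ∣ ℚ.≤ ε
  ∣∣-lub p p≤ε -p≤ε with ℚₚ.∣p∣≡p∨∣p∣≡-p p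
  ... | inj₁ e = subst (ℚ._≤ _) (sym e) p≤ε
  ... | inj₂ e = subst (ℚ._≤ _) (sym e) -p≤ε

  swap- : ∀ p q → ℚ.- (p ℚ.- q) ≡ q ℚ.- p
  swap- = solve 2 (λ p q → :- (p :- q) := q :- p) refl
    where open +-*-Solver

  dist-sym : ∀ p q → ℚ.∣ p ℚ.- q ∣ ≡ ℚ.∣ q ℚ.- p ∣
  dist-sym p q =
    trans (sym (ℚₚ.∣-p∣≡∣p∣ (p ℚ.- q))) (cong ℚ.∣_∣ (swap- p q))

  split : ∀ p q → p ≡ q ℚ.+ (p ℚ.- q)
  split = solve 2 (λ p q → p := q :+ (p :- q)) refl
    where open +-*-Solver

  near⇒≤ : ∀ p q {ε} → ℚ.∣ p ℚ.- q ∣ ℚ.≤ ε → p ℚ.≤ q ℚ.+ ε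
  near⇒≤ p q h = ℚₚ.≤-trans (ℚₚ.≤-reflexive (split p q))
    (ℚₚ.+-monoʳ-≤ q (ℚₚ.≤-trans (p≤∣p∣ (p ℚ.- q)) h))

  near⇒≥ : ∀ p q {ε} → ℚ.∣ p ℚ.- q ∣ ℚ.≤ ε → q ℚ.≤ p ℚ.+ ε
  near⇒≥ p q h = near⇒≤ q p (subst (ℚ._≤ _) (dist-sym p q) h)

  ≤⇒-≤ : ∀ p q {ε} → p ℚ.≤ q ℚ.+ ε → p ℚ.- q ℚ.≤ ε
  ≤⇒-≤ p q {ε} h =
    subst (p ℚ.- q ℚ.≤_) (cancel q ε) (ℚₚ.+-monoˡ-≤ (ℚ.- q) h)
    where
    open +-*-Solver
    cancel : ∀ q ε → (q ℚ.+ ε) ℚ.- q ≡ ε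
    cancel = solve 2 (λ q ε → (q :+ ε) :- q := ε) refl

  ≤⇒near : ∀ p q {ε} → p ℚ.≤ q ℚ.+ ε → q ℚ.≤ p ℚ.+ ε → ℚ.∣ p ℚ.- q ∣ ℚ.≤ ε
  ≤⇒near p q {ε} h k =
    ∣∣-lub (p ℚ.- q) (≤⇒-≤ p q h) (subst (ℚ._≤ ε) (sym (swap- p q)) (≤⇒-≤ q p k))

  ⊔-near : ∀ p q r s {ε} → ℚ.∣ p ℚ.- r ∣ ℚ.≤ ε → ℚ.∣ q ℚ.- s ∣ ℚ.≤ ε →
           ℚ.∣ (p ℚ.⊔ q) ℚ.- (r ℚ.⊔ s) ∣ ℚ.≤ ε
  ⊔-near p q r s h k = ≤⇒near (p ℚ.⊔ q) (r ℚ.⊔ s)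
    (⊔-≤ p q r s (near⇒≤ p r h) (near⇒≤ q s k))
    (⊔-≤ r s p q (near⇒≥ p r h) (near⇒≥ q s k))
    where
    ⊔-≤ : ∀ p q r s {ε} → p ℚ.≤ r ℚ.+ ε → q ℚ.≤ s ℚ.+ ε →
          p ℚ.⊔ q ℚ.≤ (r ℚ.⊔ s) ℚ.+ ε
    ⊔-≤ p q r s {ε} a b = ℚₚ.⊔-lub
      (ℚₚ.≤-trans a (ℚₚ.+-monoˡ-≤ ε (ℚₚ.p≤p⊔q r s)))
      (ℚₚ.≤-trans b (ℚₚ.+-monoˡ-≤ ε (ℚₚ.p≤q⊔p r s)))

  -‿near : ∀ p q {ε} → ℚ.∣ p ℚ.- q ∣ ℚ.≤ ε → ℚ.∣ (ℚ.- p) ℚ.- (ℚ.- q) ∣ ℚ.≤ ε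
  -‿near p q = subst (ℚ._≤ _)
    (trans (dist-sym p q) (cong ℚ.∣_∣ (flip p q)))
    where
    open +-*-Solver
    flip : ∀ p q → q ℚ.- p ≡ (ℚ.- p) ℚ.- (ℚ.- q)
    flip = solve 2 (λ p q → q :- p := (:- p) :- (:- q)) refl

  ∣∣-near : ∀ p q {ε} → ℚ.∣ p ℚ.- q ∣ ℚ.≤ ε → ℚ.∣ ℚ.∣ p ∣ ℚ.- ℚ.∣ q ∣ ∣ ℚ.≤ ε
  ∣∣-near p q h = ≤⇒near ℚ.∣ p ∣ ℚ.∣ q ∣ (grow p q h) (grow q p (subst (ℚ._≤ _) (dist-sym p q) h))
    where
    grow : ∀ p q {ε} → ℚ.∣ p ℚ.- q ∣ ℚ.≤ ε → ℚ.∣ p ∣ ℚ.≤ ℚ.∣ q ∣ ℚ.+ ε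
    grow p q h = ℚₚ.≤-trans
      (subst (λ t → ℚ.∣ t ∣ ℚ.≤ ℚ.∣ q ∣ ℚ.+ ℚ.∣ p ℚ.- q ∣) (sym (split p q))
        (ℚₚ.∣p+q∣≤∣p∣+∣q∣ q (p ℚ.- q)))
      (ℚₚ.+-monoʳ-≤ ℚ.∣ q ∣ h)

  +-near : ∀ p q r s {ε δ} → ℚ.∣ p ℚ.- r ∣ ℚ.≤ ε → ℚ.∣ q ℚ.- s ∣ ℚ.≤ δ →
           ℚ.∣ (p ℚ.+ q) ℚ.- (r ℚ.+ s) ∣ ℚ.≤ ε ℚ.+ δ
  +-near p q r s h k = ℚₚ.≤-trans
    (subst (λ t → ℚ.∣ t ∣ ℚ.≤ ℚ.∣ p ℚ.- r ∣ ℚ.+ ℚ.∣ q ℚ.- s ∣) (regroup p q r s)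
      (ℚₚ.∣p+q∣≤∣p∣+∣q∣ (p ℚ.- r) (q ℚ.- s)))
    (ℚₚ.+-mono-≤ h k)
    where
    open +-*-Solver
    regroup : ∀ p q r s → (p ℚ.- r) ℚ.+ (q ℚ.- s) ≡ (p ℚ.+ q) ℚ.- (r ℚ.+ s)
    regroup = solve 4 (λ p q r s → (p :- r) :+ (q :- s) := (p :+ q) :- (r :+ s)) refl

  *-bound : ∀ p q {B C} → ℚ.∣ p ∣ ℚ.≤ B → ℚ.∣ q ∣ ℚ.≤ C → ℚ.∣ p ℚ.* q ∣ ℚ.≤ B ℚ.* C
  *-bound p q {B} {C} h k = ℚₚ.≤-trans
    (ℚₚ.≤-reflexive (ℚₚ.∣p*q∣≡∣p∣*∣q∣ p q))
    (ℚₚ.≤-trans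
      (ℚₚ.*-monoˡ-≤-nonNeg ℚ.∣ p ∣ {{ℚₚ.∣-∣-nonNeg p}} k)
      (ℚₚ.*-monoʳ-≤-nonNeg C {{ℚ.nonNegative (ℚₚ.≤-trans (ℚₚ.0≤∣p∣ q) k)}} h))

  *-near : ∀ p q r s {B C δ} → ℚ.∣ p ∣ ℚ.≤ B → ℚ.∣ s ∣ ℚ.≤ C →
           ℚ.∣ p ℚ.- r ∣ ℚ.≤ δ → ℚ.∣ q ℚ.- s ∣ ℚ.≤ δ →
           ℚ.∣ (p ℚ.* q) ℚ.- (r ℚ.* s) ∣ ℚ.≤ δ ℚ.* (B ℚ.+ C)
  *-near p q r s {B} {C} {δ} hp hs h k = subst₂ ℚ._≤_
    (cong ℚ.∣_∣ (regroup p q r s)) (collect B C δ)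
    (ℚₚ.≤-trans (ℚₚ.∣p+q∣≤∣p∣+∣q∣ (p ℚ.* (q ℚ.- s)) ((p ℚ.- r) ℚ.* s))
      (ℚₚ.+-mono-≤ (*-bound p (q ℚ.- s) hp k) (*-bound (p ℚ.- r) s h hs)))
    where
    open +-*-Solver
    regroup : ∀ p q r s →
      p ℚ.* (q ℚ.- s) ℚ.+ (p ℚ.- r) ℚ.* s ≡ (p ℚ.* q) ℚ.- (r ℚ.* s)
    regroup = solve 4 (λ p q r s →
      p :* (q :- s) :+ (p :- r) :* s := (p :* q) :- (r :* s)) refl
    collect : ∀ B C δ → B ℚ.* δ ℚ.+ δ ℚ.* C ≡ δ ℚ.* (B ℚ.+ C)
    collect = solve 3 (λ B C δ → B :* δ :+ δ :* C := δ :* (B :+ C)) refl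

  quotient : ∀ D {ε} → 0ℚ ℚ.< D → 0ℚ ℚ.< ε → ∃[ δ ] (0ℚ ℚ.< δ × δ ℚ.* D ≡ ε)
  quotient D {ε} 0<D 0<ε = δ , 0<δ , δD
    where
    instance
      D+ : Positive D
      D+ = ℚ.positive 0<D
      D≢0 : ℚ.NonZero D
      D≢0 = ℚₚ.pos⇒nonZero D
      ε+ : Positive ε
      ε+ = ℚ.positive 0<ε
      1/D+ : Positive (ℚ.1/ D)
      1/D+ = ℚₚ.1/pos⇒pos D
    δ = ε ℚ.* (ℚ.1/ D)
    0<δ : 0ℚ ℚ.< δ
    0<δ = ℚₚ.positive⁻¹ δ {{ℚₚ.pos*pos⇒pos ε (ℚ.1/ D)}}
    δD : δ ℚ.* D ≡ ε
    δD = trans (ℚₚ.*-assoc ε (ℚ.1/ D) D)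
      (trans (cong (ε ℚ.*_) (ℚₚ.*-inverseˡ D)) (ℚₚ.*-identityʳ ε))

open ℚ-estimates

------------------------------------------------------------------------
-- Real numbers: Cauchy sequences of rationals.  The equality of reals is
-- _≃_, the difference being a null sequence; all operations are pointwise.

IsCauchy : (ℕ → ℚ) → Set
IsCauchy x = ∀ ε → 0ℚ ℚ.< ε →
  ∃[ N ] (∀ m n → N ℕ.≤ m → N ℕ.≤ n → ℚ.∣ x m ℚ.- x n ∣ ℚ.≤ ε)

record ℝ : Set where
  constructor mkℝ
  field
    seq    : ℕ → ℚ
    cauchy : IsCauchy seq

open ℝ

infix  4 _≃_ _≤_ _<_
infixl 6 _+_ _-_ _⊔_
infixl 7 _*_
infix  8 -_

_≃_ : ℝ → ℝ → Set
x ≃ y = ∀ ε → 0ℚ ℚ.< ε →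
  ∃[ N ] (∀ n → N ℕ.≤ n → ℚ.∣ seq x n ℚ.- seq y n ∣ ℚ.≤ ε)

_≤_ : ℝ → ℝ → Set
x ≤ y = ∀ ε → 0ℚ ℚ.< ε →
  ∃[ N ] (∀ n → N ℕ.≤ n → seq x n ℚ.≤ seq y n ℚ.+ ε)

_<_ : ℝ → ℝ → Set
x < y = ∃[ ε ] (0ℚ ℚ.< ε ×
  ∃[ N ] (∀ n → N ℕ.≤ n → seq x n ℚ.+ ε ℚ.≤ seq y n))

≃-trans : ∀ {x y z} → x ≃ y → y ≃ z → x ≃ z
≃-trans {x} {y} {z} x≃y y≃z ε 0<ε
  with x≃y (½ ℚ.* ε) (half>0 0<ε) | y≃z (½ ℚ.* ε) (half>0 0<ε)
... | M , h | N , k = M ℕ.⊔ N , λ n p → subst₂ ℚ._≤_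
  (cong ℚ.∣_∣ (telescope (seq x n) (seq y n) (seq z n))) (halves ε)
  (ℚₚ.≤-trans (ℚₚ.∣p+q∣≤∣p∣+∣q∣ (seq x n ℚ.- seq y n) (seq y n ℚ.- seq z n))
    (ℚₚ.+-mono-≤ (h n (ℕₚ.m⊔n≤o⇒m≤o M N p)) (k n (ℕₚ.m⊔n≤o⇒n≤o M N p))))
  where
  open +-*-Solver
  telescope : ∀ p q r → (p ℚ.- q) ℚ.+ (q ℚ.- r) ≡ p ℚ.- r
  telescope = solve 3 (λ p q r → (p :- q) :+ (q :- r) := p :- r) refl

fromℚ : ℚ → ℝ
fromℚ q = mkℝ (λ _ → q) λ ε 0<ε → 0 , λ _ _ _ _ →
  subst (ℚ._≤ ε) (sym (cong ℚ.∣_∣ (ℚₚ.+-inverseʳ q))) (ℚₚ.<⇒≤ 0<ε)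

0ℝ 1ℝ : ℝ
0ℝ = fromℚ 0ℚ
1ℝ = fromℚ 1ℚ

_+_ : ℝ → ℝ → ℝ
seq (x + y) n = seq x n ℚ.+ seq y n
cauchy (x + y) ε 0<ε with cauchy x (½ ℚ.* ε) (half>0 0<ε) | cauchy y (½ ℚ.* ε) (half>0 0<ε)
... | M , hx | N , hy = M ℕ.⊔ N , λ m n p q →
  subst (ℚ.∣ _ ∣ ℚ.≤_) (halves ε) (+-near (seq x m) (seq y m) (seq x n) (seq y n)
    (hx m n (ℕₚ.m⊔n≤o⇒m≤o M N p) (ℕₚ.m⊔n≤o⇒m≤o M N q))
    (hy m n (ℕₚ.m⊔n≤o⇒n≤o M N p) (ℕₚ.m⊔n≤o⇒n≤o M N q)))

-_ : ℝ → ℝ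
seq (- x) n = ℚ.- seq x n
cauchy (- x) ε 0<ε with cauchy x ε 0<ε
... | N , h = N , λ m n p q → -‿near (seq x m) (seq x n) (h m n p q)

_-_ : ℝ → ℝ → ℝ
x - y = x + (- y)

_⊔_ : ℝ → ℝ → ℝ
seq (x ⊔ y) n = seq x n ℚ.⊔ seq y n
cauchy (x ⊔ y) ε 0<ε with cauchy x ε 0<ε | cauchy y ε 0<ε
... | M , hx | N , hy = M ℕ.⊔ N , λ m n p q →
  ⊔-near (seq x m) (seq y m) (seq x n) (seq y n)
    (hx m n (ℕₚ.m⊔n≤o⇒m≤o M N p) (ℕₚ.m⊔n≤o⇒m≤o M N q))
    (hy m n (ℕₚ.m⊔n≤o⇒n≤o M N p) (ℕₚ.m⊔n≤o⇒n≤o M N q))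

∣_∣ : ℝ → ℝ
seq ∣ x ∣ n = ℚ.∣ seq x n ∣
cauchy ∣ x ∣ ε 0<ε with cauchy x ε 0<ε
... | N , h = N , λ m n p q → ∣∣-near (seq x m) (seq x n) (h m n p q)

private
  bounded : ∀ x → ∃[ B ] (0ℚ ℚ.< B × ∃[ N ] (∀ n → N ℕ.≤ n → ℚ.∣ seq x n ∣ ℚ.≤ B))
  bounded x with cauchy x 1ℚ (ℚₚ.positive⁻¹ 1ℚ)
  ... | N , h = ℚ.∣ seq x N ∣ ℚ.+ 1ℚ
    , ℚₚ.+-mono-≤-< (ℚₚ.0≤∣p∣ (seq x N)) (ℚₚ.positive⁻¹ 1ℚ)
    , N , λ n p → near⇒≤ ℚ.∣ seq x n ∣ ℚ.∣ seq x N ∣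
        (∣∣-near (seq x n) (seq x N) (h n N p ℕₚ.≤-refl))

  *-cauchy : ∀ x y → IsCauchy (λ n → seq x n ℚ.* seq y n)
  *-cauchy x y ε 0<ε = K⊔L ℕ.⊔ M⊔N , λ m n p q →
    let p₁ = ℕₚ.m⊔n≤o⇒m≤o K⊔L M⊔N p
        p₂ = ℕₚ.m⊔n≤o⇒n≤o K⊔L M⊔N p
        q₁ = ℕₚ.m⊔n≤o⇒m≤o K⊔L M⊔N q
        q₂ = ℕₚ.m⊔n≤o⇒n≤o K⊔L M⊔N q
    in subst (ℚ.∣ seq x m ℚ.* seq y m ℚ.- seq x n ℚ.* seq y n ∣ ℚ.≤_) δ[B+C]
         (*-near (seq x m) (seq y m) (seq x n) (seq y n) {B} {C} {δ}
           (hB m (ℕₚ.m⊔n≤o⇒m≤o K L p₁)) (hC n (ℕₚ.m⊔n≤o⇒n≤o K L q₁))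
           (hx m n (ℕₚ.m⊔n≤o⇒m≤o M N p₂) (ℕₚ.m⊔n≤o⇒m≤o M N q₂))
           (hy m n (ℕₚ.m⊔n≤o⇒n≤o M N p₂) (ℕₚ.m⊔n≤o⇒n≤o M N q₂)))
    where
    B = proj₁ (bounded x)
    C = proj₁ (bounded y)
    K = proj₁ (proj₂ (proj₂ (bounded x)))
    L = proj₁ (proj₂ (proj₂ (bounded y)))
    hB = proj₂ (proj₂ (proj₂ (bounded x)))
    hC = proj₂ (proj₂ (proj₂ (bounded y)))
    D = quotient (B ℚ.+ C)
          (ℚₚ.+-mono-< (proj₁ (proj₂ (bounded x))) (proj₁ (proj₂ (bounded y)))) 0<ε
    δ = proj₁ D
    δ[B+C] = proj₂ (proj₂ D)
    M = proj₁ (cauchy x δ (proj₁ (proj₂ D)))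
    N = proj₁ (cauchy y δ (proj₁ (proj₂ D)))
    hx = proj₂ (cauchy x δ (proj₁ (proj₂ D)))
    hy = proj₂ (cauchy y δ (proj₁ (proj₂ D)))
    K⊔L = K ℕ.⊔ L
    M⊔N = M ℕ.⊔ N

_*_ : ℝ → ℝ → ℝ
x * y = mkℝ (λ n → seq x n ℚ.* seq y n) (*-cauchy x y)

-- Sgn r s says s = sgn r.  It is a relation because trichotomy of reals,
-- hence a total function sgn, is not available constructively.
data Sgn (r : ℝ) : ℝ → Set where
  pos  : 0ℝ < r → Sgn r 1ℝ
  null : r ≃ 0ℝ → Sgn r 0ℝ
  neg  : r < 0ℝ → Sgn r (- 1ℝ)

∣r∣≃1⇒Sgn : ∀ r → ∣ r ∣ ≃ 1ℝ → ∃ (Sgn r)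
∣r∣≃1⇒Sgn r ∣r∣≃1 = [ positive , negative ]′ (ℚₚ.∣p∣≡p∨∣p∣≡-p (seq r N))
  where
  ¼ = ½ ℚ.* ½
  0<¼ : 0ℚ ℚ.< ¼
  0<¼ = ℚₚ.positive⁻¹ ¼
  M₁ = proj₁ (cauchy r ¼ 0<¼)
  M₂ = proj₁ (∣r∣≃1 ¼ 0<¼)
  N = M₁ ℕ.⊔ M₂
  close : ∀ n → N ℕ.≤ n → ℚ.∣ seq r n ℚ.- seq r N ∣ ℚ.≤ ¼
  close n p = proj₂ (cauchy r ¼ 0<¼) n N
    (ℕₚ.m⊔n≤o⇒m≤o M₁ M₂ p) (ℕₚ.m≤m⊔n M₁ M₂)
  unit : 1ℚ ℚ.≤ ℚ.∣ seq r N ∣ ℚ.+ ¼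
  unit = near⇒≥ ℚ.∣ seq r N ∣ 1ℚ (proj₂ (∣r∣≃1 ¼ 0<¼) N (ℕₚ.m≤n⊔m M₁ M₂))
  open +-*-Solver
  ½≤ : ∀ p q → 1ℚ ℚ.≤ p ℚ.+ ¼ → p ℚ.≤ q ℚ.+ ¼ → ½ ℚ.≤ q
  ½≤ p q h k = subst (½ ℚ.≤_)
    (solve 1 (λ q → ((q :+ con ¼) :+ con ¼) :+ con (ℚ.- ½) := q) refl q)
    (ℚₚ.+-monoˡ-≤ (ℚ.- ½) (ℚₚ.≤-trans h (ℚₚ.+-monoˡ-≤ ¼ k)))
  positive : ℚ.∣ seq r N ∣ ≡ seq r N → ∃ (Sgn r)
  positive e = 1ℝ , pos (½ , ℚₚ.positive⁻¹ ½ , N , λ n p →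
    subst (ℚ._≤ seq r n) (sym (ℚₚ.+-identityˡ ½))
      (½≤ (seq r N) (seq r n) (subst (λ t → 1ℚ ℚ.≤ t ℚ.+ ¼) e unit)
          (near⇒≥ (seq r n) (seq r N) (close n p))))
  negative : ℚ.∣ seq r N ∣ ≡ ℚ.- seq r N → ∃ (Sgn r)
  negative e = - 1ℝ , neg (½ , ℚₚ.positive⁻¹ ½ , N , λ n p →
    subst (seq r n ℚ.+ ½ ℚ.≤_) (ℚₚ.+-inverseʳ (seq r n)) (ℚₚ.+-monoʳ-≤ (seq r n)
      (½≤ (ℚ.- seq r N) (ℚ.- seq r n) (subst (λ t → 1ℚ ℚ.≤ t ℚ.+ ¼) e unit)
          (near⇒≥ (ℚ.- seq r n) (ℚ.- seq r N) (-‿near (seq r n) (seq r N) (close n p))))))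

------------------------------------------------------------------------
-- Extended reals.  An element a of [-∞,+∞] is represented by its closed
-- lower cut { q ∈ ℚ | q ≤ a }, so -∞ is the empty cut and +∞ is all of ℚ;
-- the order is inclusion.  Every family of reals then has an infimum, the
-- empty family having infimum +∞.

record ℝ̄ : Set₁ where
  field
    _∈cut   : ℚ → Set
    ∈cut-↓  : ∀ {p q} → p ℚ.≤ q → q ∈cut → p ∈cut
    ∈cut-cl : ∀ {q} → (∀ p → p ℚ.< q → p ∈cut) → q ∈cut

infix 4 _≤̄_
_≤̄_ : ℝ̄ → ℝ̄ → Set
a ≤̄ b = ∀ q → ℝ̄._∈cut a q → ℝ̄._∈cut b q

inf : {I : Set} → (I → ℝ) → ℝ̄
inf {I} a = record
  { _∈cut   = λ q → ∀ i → fromℚ q ≤ a i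
  ; ∈cut-↓  = λ p≤q h i ε 0<ε → let (N , k) = h i ε 0<ε in
                N , λ n N≤n → ℚₚ.≤-trans p≤q (k n N≤n)
  ; ∈cut-cl = λ {q} h i ε 0<ε →
      let ε/2     = ½ ℚ.* ε
          (N , k) = h (q ℚ.- ε/2) (below q (half>0 0<ε)) i ε/2 (half>0 0<ε)
      in N , λ n N≤n → subst₂ ℚ._≤_ (restore q ε/2)
           (trans (ℚₚ.+-assoc (seq (a i) n) ε/2 ε/2) (cong (seq (a i) n ℚ.+_) (halves ε)))
           (ℚₚ.+-monoˡ-≤ ε/2 (k n N≤n))
  }
  where
  restore : ∀ q δ → (q ℚ.- δ) ℚ.+ δ ≡ q
  restore = solve 2 (λ q δ → (q :- δ) :+ δ := q) refl
    where open +-*-Solver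
  below : ∀ q {δ} → 0ℚ ℚ.< δ → q ℚ.- δ ℚ.< q
  below q {δ} 0<δ = subst (q ℚ.- δ ℚ.<_) (ℚₚ.+-identityʳ q)
    (ℚₚ.+-monoʳ-< q (ℚₚ.neg-antimono-< 0<δ))

-- The embedding of ℝ: its cut is { q | q ≤ r }.
⌈_⌉ : ℝ → ℝ̄
⌈ r ⌉ = inf {I = ⊤} (λ _ → r)

------------------------------------------------------------------------
-- Locally finite simple graphs, the vertices adjacent to x being listed
-- without repetition by neighbours x.

record Graph : Set₁ where
  field
    V          : Set
    _≟_        : DecidableEquality V
    neighbours : V → List V

  infix 4 _~_
  _~_ : V → V → Set
  x ~ y = y ∈ neighbours x

  field
    neighbours-unique : ∀ x → Unique (neighbours x)
    ~-sym             : ∀ {x y} → x ~ y → y ~ x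
    ~-irrefl          : ∀ x → x ∉ neighbours x

  -- Walk x n y: there is a walk with n edges from x to y.
  data Walk (x : V) : ℕ → V → Set where
    stop : Walk x 0 x
    step : ∀ {n y z} → Walk x n y → y ~ z → Walk x (suc n) z

  -- d(x,y) = n
  IsDistance : V → V → ℕ → Set
  IsDistance x y n = Walk x n y × (∀ m → Walk x m y → n ℕ.≤ m)

  -- d(x,y) ≤ R
  Within : ℕ → V → V → Set
  Within R x y = ∃[ n ] (IsDistance x y n × n ℕ.≤ R)

  -- The vertices at distance at most R from x, possibly with repetitions.
  ball : ℕ → V → List V
  ball zero    x = x ∷ []
  ball (suc R) x = ball R x ++ concatMap neighbours (ball R x)

  sum : List ℝ → ℝ
  sum = foldr _+_ 0ℝ

  Δ : (V → ℝ) → V → ℝ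
  Δ f x = sum (map (λ y → f y - f x) (neighbours x))

  -- The maximum of ∣ f y - f x ∣ over the ball.  Starting it from 0 is
  -- harmless: the ball contains x, and all the terms are nonnegative.
  ∣∇⟨_⟩_∣ : ℕ → (V → ℝ) → V → ℝ
  ∣∇⟨ R ⟩ f ∣ x = foldr _⊔_ 0ℝ (map (λ y → ∣ f y - f x ∣) (ball R x))

  record Admissible (R : ℕ) (x y : V) : Set where
    field
      f       : V → ℝ
      unit    : ∣∇⟨ R ⟩ f ∣ x ≃ 1ℝ
      attains : ∣ f y - f x ∣ ≃ ∣∇⟨ R ⟩ f ∣ x
      -- σ = sgn (f y - f x) is no restriction on f: see admissible below.
      σ       : ℝ
      sgn     : Sgn (f y - f x) σ

    functional : ℝ
    functional = Δ ∣∇⟨ R ⟩ f ∣ x - (Δ f y - Δ f x) * σ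

  admissible : ∀ {R x y} (f : V → ℝ) → ∣∇⟨ R ⟩ f ∣ x ≃ 1ℝ →
               ∣ f y - f x ∣ ≃ ∣∇⟨ R ⟩ f ∣ x → Admissible R x y
  admissible {R} {x} {y} f unit attains = record
    { f = f ; unit = unit ; attains = attains ; σ = proj₁ s ; sgn = proj₂ s }
    where
    s = ∣r∣≃1⇒Sgn (f y - f x)
          (≃-trans {∣ f y - f x ∣} {∣∇⟨ R ⟩ f ∣ x} {1ℝ} attains unit)

  K : ℕ → V → V → ℝ̄
  K R x y = inf (Admissible.functional {R} {x} {y})

  walk⇒ball : ∀ {x y n R} → Walk x n y → n ℕ.≤ R → y ∈ ball R x
  walk⇒ball {R = zero}  stop z≤n = here refl
  walk⇒ball {R = suc R} stop z≤n = ∈-++⁺ˡ (walk⇒ball {R = R} stop z≤n)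
  walk⇒ball {x} {R = suc R} (step w e) (s≤s n≤R) =
    ∈-++⁺ʳ (ball R x) (∈-concatMap⁺ neighbours (lose (walk⇒ball w n≤R) e))

  ball⇒walk : ∀ R {x y} → y ∈ ball R x → ∃[ n ] (Walk x n y × n ℕ.≤ R)
  ball⇒walk zero (here refl) = 0 , stop , z≤n
  ball⇒walk (suc R) {x} h with ∈-++⁻ (ball R x) h
  ... | inj₁ h₁ = let (n , w , p) = ball⇒walk R h₁ in n , w , ℕₚ.m≤n⇒m≤1+n p
  ... | inj₂ h₂ =
    let (z , z∈ , e) = find (∈-concatMap⁻ neighbours {xs = ball R x} h₂)
        (n , w , p)  = ball⇒walk R z∈
    in suc n , step w e , s≤s p

  ball⇒within : ∀ R {x y} → y ∈ ball R x → Within R x y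
  ball⇒within zero (here refl) = 0 , (stop , λ _ _ → z≤n) , z≤n
  ball⇒within (suc R) {x} {y} h with DecMembership._∈?_ _≟_ y (ball R x)
  ... | yes h′ = let (n , d , p) = ball⇒within R h′ in n , d , ℕₚ.m≤n⇒m≤1+n p
  ... | no  ∉R = suc R , (subst (λ k → Walk x k y) n≡ w , far) , ℕₚ.≤-refl
    where
    far : ∀ m → Walk x m y → suc R ℕ.≤ m
    far m v = ℕₚ.≰⇒> (λ m≤R → ∉R (walk⇒ball v m≤R))
    n = proj₁ (ball⇒walk (suc R) h)
    w = proj₁ (proj₂ (ball⇒walk (suc R) h))
    n≡ : n ≡ suc R
    n≡ = ℕₚ.≤-antisym (proj₂ (proj₂ (ball⇒walk (suc R) h))) (far n w)

  ∈ball⇔Within : ∀ {R x y} → y ∈ ball R x ⇔ Within R x y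
  ∈ball⇔Within {R} = mk⇔ (ball⇒within R) (λ { (_ , (w , _) , p) → walk⇒ball w p })

------------------------------------------------------------------------
-- The hexagonal lattice.  Let e₁, e₂, e₃ be unit vectors of the plane at
-- mutual angles of 120°, so e₁ + e₂ + e₃ = 0.  The vertices of the regular
-- hexagonal tiling with side 1 are
--   a i j = i (e₁ - e₂) + j (e₁ - e₃)   and   b i j = a i j + e₁,
-- and the edges join each a i j to a i j + e₁ = b i j,
-- a i j + e₂ = b (i - 1) j and a i j + e₃ = b i (j - 1).

data Vertex : Set where
  a b : ℤ → ℤ → Vertex

hexNeighbours : Vertex → List Vertex
hexNeighbours (a i j) = b i j ∷ b (ℤ.pred i) j ∷ b i (ℤ.pred j) ∷ []
hexNeighbours (b i j) = a i j ∷ a (ℤ.suc i) j ∷ a i (ℤ.suc j) ∷ []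

hexagonalLattice : Graph
hexagonalLattice = record
  { V                 = Vertex
  ; _≟_               = _≟_
  ; neighbours        = hexNeighbours
  ; neighbours-unique = unique
  ; ~-sym             = λ {x} {y} → symmetric x y
  ; ~-irrefl          = irreflexive
  }
  where
  a-inj : ∀ {i j k l} → a i j ≡ a k l → i ≡ k × j ≡ l
  a-inj refl = refl , refl

  b-inj : ∀ {i j k l} → b i j ≡ b k l → i ≡ k × j ≡ l
  b-inj refl = refl , refl

  _≟_ : DecidableEquality Vertex
  a i j ≟ a k l with i ℤ.≟ k | j ℤ.≟ l
  ... | yes refl | yes refl = yes refl
  ... | no i≢k   | _        = no (i≢k ∘ proj₁ ∘ a-inj)
  ... | _        | no j≢l   = no (j≢l ∘ proj₂ ∘ a-inj)
  a i j ≟ b k l = no λ ()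
  b i j ≟ a k l = no λ ()
  b i j ≟ b k l with i ℤ.≟ k | j ℤ.≟ l
  ... | yes refl | yes refl = yes refl
  ... | no i≢k   | _        = no (i≢k ∘ proj₁ ∘ b-inj)
  ... | _        | no j≢l   = no (j≢l ∘ proj₂ ∘ b-inj)

  i≢suc : ∀ i → i ≢ ℤ.suc i
  i≢suc i = ℤₚ.i≢suc[i] {i}

  i≢pred : ∀ i → i ≢ ℤ.pred i
  i≢pred i e = i≢suc (ℤ.pred i) (trans (sym e) (sym (ℤₚ.suc-pred i)))

  unique : ∀ x → Unique (hexNeighbours x)
  unique (a i j) =
      ((i≢pred i ∘ proj₁ ∘ b-inj) ∷ (i≢pred j ∘ proj₂ ∘ b-inj) ∷ [])
    ∷ ((i≢pred i ∘ sym ∘ proj₁ ∘ b-inj) ∷ []) ∷ [] ∷ []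
  unique (b i j) =
      ((i≢suc i ∘ proj₁ ∘ a-inj) ∷ (i≢suc j ∘ proj₂ ∘ a-inj) ∷ [])
    ∷ ((i≢suc i ∘ sym ∘ proj₁ ∘ a-inj) ∷ []) ∷ [] ∷ []

  symmetric : ∀ x y → y ∈ hexNeighbours x → x ∈ hexNeighbours y
  symmetric (a i j) _ (here refl)                 = here refl
  symmetric (a i j) _ (there (here refl))         =
    there (here (cong (λ k → a k j) (sym (ℤₚ.suc-pred i))))
  symmetric (a i j) _ (there (there (here refl))) =
    there (there (here (cong (a i) (sym (ℤₚ.suc-pred j)))))
  symmetric (b i j) _ (here refl)                 = here refl
  symmetric (b i j) _ (there (here refl))         =
    there (here (cong (λ k → b k j) (sym (ℤₚ.pred-suc i))))
  symmetric (b i j) _ (there (there (here refl))) =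
    there (there (here (cong (b i) (sym (ℤₚ.pred-suc j)))))

  irreflexive : ∀ x → x ∉ hexNeighbours x
  irreflexive (a _ _) (there (there (there ())))
  irreflexive (b _ _) (there (there (there ())))

-- Label the edges of the lattice by their three directions and let k v be the
-- neighbour of v in direction k.  A word of odd length in the directions acts
-- on the lattice as a point reflection, so k e d v = d e k v for all directions
-- k, e, d.  Hence, for y = e d x, the neighbour k y of y is within distance 2 of
-- the neighbour k x of x, and with s = sgn (f y - f x)
--   (f (k y) - f (k x)) s ≤ |∇₂ f| (k x).
-- For y = d x the same bound follows from
--   (f (k y) - f x) s ≤ |∇₂ f| (x) = (f y - f x) s
-- and from y being within distance 2 of k x.  Summing over k gives the claim.
-- All operations on reals being pointwise, this is carried out for the rational
-- approximations, the hypotheses on f holding up to ε.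
module Submission where

open import Data.Empty using (⊥-elim)
open import Data.Fin using (Fin; zero; suc)
open import Data.Integer as ℤ using (ℤ; 0ℤ; 1ℤ)
import Data.Integer.Properties as ℤₚ
import Data.Integer.Solver
open import Data.List using (_∷_; foldr; map; tabulate)
open import Data.List.Membership.Propositional using (_∈_)
open import Data.List.Membership.Propositional.Properties using (∈-tabulate⁺; ∈-tabulate⁻)
open import Data.List.Relation.Unary.Any using (here; there)
open import Data.Nat as ℕ using (ℕ; s≤s; z≤n)
import Data.Nat.Properties as ℕₚ
open import Data.Product using (∃-syntax; _×_; _,_)
open import Data.Rational as ℚ using (ℚ; 0ℚ; 1ℚ; ½)
import Data.Rational.Properties as ℚₚ
open import Data.Rational.Solver using (module +-*-Solver)
open import Relation.Binary.PropositionalEquality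
  using (_≡_; refl; sym; trans; cong; cong₂; subst; subst₂)
open import Relation.Nullary.Decidable using (toWitnessFalse)

open import Defs
open Graph hexagonalLattice
open ℝ using (seq)
open ℚ-estimates

Direction : Set
Direction = Fin 3

-- Shifts from the `b`-end to the `a`-end of an edge. The other end uses their negatives, so each
-- `along k` is an involution.
δ₁ δ₂ : Direction → ℤ
δ₁ zero             = 0ℤ
δ₁ (suc zero)       = 1ℤ
δ₁ (suc (suc zero)) = 0ℤ
δ₂ zero             = 0ℤ
δ₂ (suc zero)       = 0ℤ
δ₂ (suc (suc zero)) = 1ℤ

along : Direction → V → V
along k (a i j) = b (ℤ.- δ₁ k ℤ.+ i) (ℤ.- δ₂ k ℤ.+ j)
along k (b i j) = a (δ₁ k ℤ.+ i) (δ₂ k ℤ.+ j)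

-- `pred` and `suc` unfold to adding -1 and 1 on the left, so only the zero shifts need rewriting.
neighbours≡along : ∀ v → neighbours v ≡ tabulate (λ k → along k v)
neighbours≡along (a i j) rewrite ℤₚ.+-identityˡ i | ℤₚ.+-identityˡ j = refl
neighbours≡along (b i j) rewrite ℤₚ.+-identityˡ i | ℤₚ.+-identityˡ j = refl

~-along : ∀ v k → v ~ along k v
~-along v k = subst (along k v ∈_) (sym (neighbours≡along v)) (∈-tabulate⁺ {f = λ d → along d v} k)

~⇒along : ∀ {v w} → v ~ w → ∃[ k ] w ≡ along k v
~⇒along {v} {w} e = ∈-tabulate⁻ (subst (w ∈_) (neighbours≡along v) e)

-- From either sublattice, the first and third shifts carry the same sign, so reversing the word
-- only permutes summands.
along-reverse : ∀ k e d v → along k (along e (along d v)) ≡ along d (along e (along k v))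
along-reverse k e d = λ where
    (a i j) → cong₂ b (+-reverse (ℤ.- δ₁ k) (δ₁ e) (ℤ.- δ₁ d) i)
                      (+-reverse (ℤ.- δ₂ k) (δ₂ e) (ℤ.- δ₂ d) j)
    (b i j) → cong₂ a (+-reverse (δ₁ k) (ℤ.- δ₁ e) (δ₁ d) i)
                      (+-reverse (δ₂ k) (ℤ.- δ₂ e) (δ₂ d) j)
  where
  open Data.Integer.Solver.+-*-Solver
  +-reverse : ∀ p q r i → p ℤ.+ (q ℤ.+ (r ℤ.+ i)) ≡ r ℤ.+ (q ℤ.+ (p ℤ.+ i))
  +-reverse = solve 4 (λ p q r i → p :+ (q :+ (r :+ i)) := r :+ (q :+ (p :+ i))) refl

centre∈ball : ∀ v → v ∈ ball 2 v
centre∈ball v = walk⇒ball {R = 2} stop z≤n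

along²∈ball : ∀ d e v → along e (along d v) ∈ ball 2 v
along²∈ball d e v =
  walk⇒ball {R = 2} (step (step stop (~-along v d)) (~-along (along d v) e)) ℕₚ.≤-refl

along∈ball-along : ∀ d k v → along d v ∈ ball 2 (along k v)
along∈ball-along d k v = walk⇒ball {R = 2}
  (step (step stop (~-sym (~-along v k))) (~-along v d)) ℕₚ.≤-refl

along³∈ball-along : ∀ d e k v → along k (along e (along d v)) ∈ ball 2 (along k v)
along³∈ball-along d e k v = subst (_∈ ball 2 (along k v)) (sym (along-reverse k e d v))
  (along²∈ball e d (along k v))

-- Records a word of directions rather than a distance. Overlap is harmless: `two d d` describes `x`
-- again.
data Near (x : V) : V → Set where
  same : Near x x
  one  : ∀ d → Near x (along d x)
  two  : ∀ d e → Near x (along e (along d x))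

within⇒near : ∀ {x y} → Within 2 x y → Near x y
within⇒near (_ , (stop , _) , _) = same
within⇒near (_ , (step stop p , _) , _) with ~⇒along p
... | d , refl = one d
within⇒near (_ , (step (step stop p) q , _) , _) with ~⇒along p
... | d , refl with ~⇒along q
... | e , refl = two d e
within⇒near (_ , (step (step (step _ _) _) _ , _) , s≤s (s≤s ()))

-- Nested like `sum` over three neighbours, final zero included, so that `seq-Δ` only has to replace
-- the neighbour list.
Σ₃ : (Direction → ℚ) → ℚ
Σ₃ h = h zero ℚ.+ (h (suc zero) ℚ.+ (h (suc (suc zero)) ℚ.+ 0ℚ))

seq-Δ : ∀ f v n → seq (Δ f v) n ≡ Σ₃ (λ k → seq (f (along k v)) n ℚ.- seq (f v) n)
seq-Δ f v n = cong (λ ns → seq (sum (map (λ w → f w - f v) ns)) n) (neighbours≡along v)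

∈⇒≤-foldr-⊔ : ∀ {A : Set} (h : A → ℝ) n {v vs} → v ∈ vs →
              seq (h v) n ℚ.≤ seq (foldr _⊔_ 0ℝ (map h vs)) n
∈⇒≤-foldr-⊔ h n {v} {_ ∷ vs} (here refl) = ℚₚ.p≤p⊔q (seq (h v) n) _
∈⇒≤-foldr-⊔ h n {v} {u ∷ vs} (there v∈) =
  ℚₚ.≤-trans (∈⇒≤-foldr-⊔ h n v∈) (ℚₚ.p≤q⊔p (seq (h u) n) _)

gradient-bound : ∀ R f {v w} n → w ∈ ball R v →
                 ℚ.∣ seq (f w) n ℚ.- seq (f v) n ∣ ℚ.≤ seq (∣∇⟨ R ⟩ f ∣ v) n
gradient-bound R f {v} n = ∈⇒≤-foldr-⊔ (λ w → ∣ f w - f v ∣) n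

-- One index of the Cauchy sequences is frozen: `G` stands for the gradient, `s` for the sign, `ε`
-- for the error in attainment.
module Approximation
  (f G : V → ℚ) (s ε : ℚ) (0≤ε : 0ℚ ℚ.≤ ε)
  (bound : ∀ {v w} → w ∈ ball 2 v → (f w ℚ.- f v) ℚ.* s ℚ.≤ G v)
  {x y : V} (attained : G x ℚ.≤ (f y ℚ.- f x) ℚ.* s ℚ.+ ε)
  where

  open +-*-Solver

  bound+ε : ∀ {v w} → w ∈ ball 2 v → (f w ℚ.- f v) ℚ.* s ℚ.≤ G v ℚ.+ ε
  bound+ε {v} w∈ = ℚₚ.≤-trans (ℚₚ.≤-reflexive (sym (ℚₚ.+-identityʳ _)))
    (ℚₚ.+-mono-≤ (bound w∈) 0≤ε)

  -- By `attained`, `f y * s` is maximal on the ball around `x` up to `ε`. So `w` may be replaced by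
  -- `y`, which lies in the ball around `u`.
  bound-via : ∀ {u w} → w ∈ ball 2 x → y ∈ ball 2 u → (f w ℚ.- f u) ℚ.* s ℚ.≤ G u ℚ.+ ε
  bound-via {u} {w} w∈ y∈ = subst₂ ℚ._≤_
    (regroup (f w) (f x) (f y) (f u) s)
    (cancel ((f y ℚ.- f x) ℚ.* s) (G u) ε)
    (ℚₚ.+-monoˡ-≤ (ℚ.- ((f y ℚ.- f x) ℚ.* s))
      (ℚₚ.+-mono-≤ (ℚₚ.≤-trans (bound w∈) attained) (bound y∈)))
    where
    regroup : ∀ p q r t s →
      ((p ℚ.- q) ℚ.* s ℚ.+ (r ℚ.- t) ℚ.* s) ℚ.- (r ℚ.- q) ℚ.* s ≡ (p ℚ.- t) ℚ.* s
    regroup = solve 5 (λ p q r t s →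
      ((p :- q) :* s :+ (r :- t) :* s) :- (r :- q) :* s := (p :- t) :* s) refl
    cancel : ∀ p g ε → ((p ℚ.+ ε) ℚ.+ g) ℚ.- p ≡ g ℚ.+ ε
    cancel = solve 3 (λ p g ε → ((p :+ ε) :+ g) :- p := g :+ ε) refl

  transport : Near x y → ∀ k →
    (f (along k y) ℚ.- f (along k x)) ℚ.* s ℚ.≤ G (along k x) ℚ.+ ε
  transport same      k = bound+ε (centre∈ball (along k x))
  transport (one d)   k = bound-via (along²∈ball d k x) (along∈ball-along d k x)
  transport (two d e) k = bound+ε (along³∈ball-along d e k x)

  summand : Direction → ℚ
  summand k = (G (along k x) ℚ.- G x) ℚ.-
    ((f (along k y) ℚ.- f y) ℚ.- (f (along k x) ℚ.- f x)) ℚ.* s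

  -- One `ε` comes from `transport`, the other from trading `G x` for `(f y - f x) * s`.
  summand≥ : Near x y → ∀ k → 0ℚ ℚ.≤ summand k ℚ.+ (ε ℚ.+ ε)
  summand≥ near k = subst₂ ℚ._≤_ (ℚₚ.+-inverseʳ lower)
    (regroup (f (along k y)) (f (along k x)) (f y) (f x) s (G (along k x)) (G x) ε)
    (ℚₚ.+-monoˡ-≤ (ℚ.- lower) (ℚₚ.+-mono-≤ (transport near k) attained))
    where
    lower = (f (along k y) ℚ.- f (along k x)) ℚ.* s ℚ.+ G x
    regroup : ∀ w z y x s g h ε →
      ((g ℚ.+ ε) ℚ.+ ((y ℚ.- x) ℚ.* s ℚ.+ ε)) ℚ.- ((w ℚ.- z) ℚ.* s ℚ.+ h) ≡
      ((g ℚ.- h) ℚ.- ((w ℚ.- y) ℚ.- (z ℚ.- x)) ℚ.* s) ℚ.+ (ε ℚ.+ ε)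
    regroup = solve 8 (λ w z y x s g h ε →
      ((g :+ ε) :+ ((y :- x) :* s :+ ε)) :- ((w :- z) :* s :+ h) :=
      ((g :- h) :- ((w :- y) :- (z :- x)) :* s) :+ (ε :+ ε)) refl

  Σ-summand≥ : Near x y → 0ℚ ℚ.≤ Σ₃ summand ℚ.+ Σ₃ (λ _ → ε ℚ.+ ε)
  Σ-summand≥ near = subst (0ℚ ℚ.≤_)
    (regroup (summand zero) (summand (suc zero)) (summand (suc (suc zero))) (ε ℚ.+ ε))
    (ℚₚ.+-mono-≤ (summand≥ near zero)
      (ℚₚ.+-mono-≤ (summand≥ near (suc zero)) (summand≥ near (suc (suc zero)))))
    where
    regroup : ∀ p q r η →
      (p ℚ.+ η) ℚ.+ ((q ℚ.+ η) ℚ.+ (r ℚ.+ η)) ≡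
      (p ℚ.+ (q ℚ.+ (r ℚ.+ 0ℚ))) ℚ.+ (η ℚ.+ (η ℚ.+ (η ℚ.+ 0ℚ)))
    regroup = solve 4 (λ p q r η →
      (p :+ η) :+ ((q :+ η) :+ (r :+ η)) :=
      (p :+ (q :+ (r :+ con 0ℚ))) :+ (η :+ (η :+ (η :+ con 0ℚ)))) refl

  Σ-summand≡ : Σ₃ summand ≡
    Σ₃ (λ k → G (along k x) ℚ.- G x) ℚ.-
    (Σ₃ (λ k → f (along k y) ℚ.- f y) ℚ.- Σ₃ (λ k → f (along k x) ℚ.- f x)) ℚ.* s
  Σ-summand≡ = regroup s
    (G (along zero x) ℚ.- G x) (f (along zero y) ℚ.- f y) (f (along zero x) ℚ.- f x)
    (G (along (suc zero) x) ℚ.- G x) (f (along (suc zero) y) ℚ.- f y)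
    (f (along (suc zero) x) ℚ.- f x)
    (G (along (suc (suc zero)) x) ℚ.- G x) (f (along (suc (suc zero)) y) ℚ.- f y)
    (f (along (suc (suc zero)) x) ℚ.- f x)
    where
    regroup : ∀ s g₀ p₀ q₀ g₁ p₁ q₁ g₂ p₂ q₂ →
      (g₀ ℚ.- (p₀ ℚ.- q₀) ℚ.* s) ℚ.+
        ((g₁ ℚ.- (p₁ ℚ.- q₁) ℚ.* s) ℚ.+ ((g₂ ℚ.- (p₂ ℚ.- q₂) ℚ.* s) ℚ.+ 0ℚ)) ≡
      (g₀ ℚ.+ (g₁ ℚ.+ (g₂ ℚ.+ 0ℚ))) ℚ.-
      ((p₀ ℚ.+ (p₁ ℚ.+ (p₂ ℚ.+ 0ℚ))) ℚ.- (q₀ ℚ.+ (q₁ ℚ.+ (q₂ ℚ.+ 0ℚ)))) ℚ.* s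
    regroup = solve 10 (λ s g₀ p₀ q₀ g₁ p₁ q₁ g₂ p₂ q₂ →
      (g₀ :- (p₀ :- q₀) :* s) :+
        ((g₁ :- (p₁ :- q₁) :* s) :+ ((g₂ :- (p₂ :- q₂) :* s) :+ con 0ℚ)) :=
      (g₀ :+ (g₁ :+ (g₂ :+ con 0ℚ))) :-
      ((p₀ :+ (p₁ :+ (p₂ :+ con 0ℚ))) :- (q₀ :+ (q₁ :+ (q₂ :+ con 0ℚ)))) :* s) refl

  functional≥ : Near x y → 0ℚ ℚ.≤
    (Σ₃ (λ k → G (along k x) ℚ.- G x) ℚ.-
    (Σ₃ (λ k → f (along k y) ℚ.- f y) ℚ.- Σ₃ (λ k → f (along k x) ℚ.- f x)) ℚ.* s)
    ℚ.+ Σ₃ (λ _ → ε ℚ.+ ε)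
  functional≥ near =
    subst (λ t → 0ℚ ℚ.≤ t ℚ.+ Σ₃ (λ _ → ε ℚ.+ ε)) Σ-summand≡ (Σ-summand≥ near)

-- A strict inequality between reals fixes the sign of all late approximations, so these equalities
-- are exact and cost no error.
Sgn-eventually : ∀ {r σ} → Sgn r σ → ∣ r ∣ ≃ 1ℝ → ∃[ N ] (∀ n → N ℕ.≤ n →
  ℚ.∣ seq σ n ∣ ≡ 1ℚ × ℚ.∣ seq r n ∣ ≡ seq r n ℚ.* seq σ n)
Sgn-eventually {r} (pos (ε , 0<ε , N , h)) _ = N , λ n N≤n → refl ,
  trans (ℚₚ.0≤p⇒∣p∣≡p (ℚₚ.≤-trans (ℚₚ.<⇒≤ 0<ε)
          (subst (ℚ._≤ seq r n) (ℚₚ.+-identityˡ ε) (h n N≤n))))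
        (sym (ℚₚ.*-identityʳ (seq r n)))
Sgn-eventually {r} (neg (ε , 0<ε , N , h)) _ = N , λ n N≤n → refl ,
  trans (sym (ℚₚ.∣-p∣≡∣p∣ (seq r n)))
    (trans (ℚₚ.0≤p⇒∣p∣≡p (ℚₚ.neg-antimono-≤ (ℚₚ.≤-trans
             (subst (ℚ._≤ seq r n ℚ.+ ε) (ℚₚ.+-identityʳ (seq r n))
               (ℚₚ.+-monoʳ-≤ (seq r n) (ℚₚ.<⇒≤ 0<ε)))
             (h n N≤n))))
      (negate (seq r n)))
  where
  open +-*-Solver
  negate : ∀ p → ℚ.- p ≡ p ℚ.* (ℚ.- 1ℚ)
  negate = solve 1 (λ p → :- p := p :* con (ℚ.- 1ℚ)) refl
-- At a common late index the two hypotheses would give 1 ≤ 1/4 + 1/4.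
Sgn-eventually {r} (null r≃0) ∣r∣≃1 =
  let ¼        = ½ ℚ.* ½
      0<¼      = ℚₚ.positive⁻¹ ¼
      (M , h)  = r≃0 ¼ 0<¼
      (N , k)  = ∣r∣≃1 ¼ 0<¼
      m        = M ℕ.⊔ N
      ∣r∣≤¼    = subst (λ t → ℚ.∣ t ∣ ℚ.≤ ¼) (ℚₚ.+-identityʳ (seq r m))
                   (h m (ℕₚ.m≤m⊔n M N))
      1≤∣r∣+¼  = near⇒≥ ℚ.∣ seq r m ∣ 1ℚ (k m (ℕₚ.m≤n⊔m M N))
  in ⊥-elim (toWitnessFalse {a? = 1ℚ ℚₚ.≤? ¼ ℚ.+ ¼} _
       (ℚₚ.≤-trans 1≤∣r∣+¼ (ℚₚ.+-monoˡ-≤ ¼ ∣r∣≤¼)))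

*-sign-≤ : ∀ p {s B} → ℚ.∣ s ∣ ≡ 1ℚ → ℚ.∣ p ∣ ℚ.≤ B → p ℚ.* s ℚ.≤ B
*-sign-≤ p {s} ∣s∣≡1 ∣p∣≤B = ℚₚ.≤-trans (p≤∣p∣ (p ℚ.* s)) (ℚₚ.≤-trans
  (ℚₚ.≤-reflexive (trans (ℚₚ.∣p*q∣≡∣p∣*∣q∣ p s)
    (trans (cong (ℚ.∣ p ∣ ℚ.*_) ∣s∣≡1) (ℚₚ.*-identityʳ ℚ.∣ p ∣))))
  ∣p∣≤B)

≤-trans : ∀ {r s t} → r ≤ s → s ≤ t → r ≤ t
≤-trans {t = t} r≤s s≤t ε 0<ε with r≤s (½ ℚ.* ε) (half>0 0<ε) | s≤t (½ ℚ.* ε) (half>0 0<ε)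
... | M , h | N , k = M ℕ.⊔ N , λ n p →
  ℚₚ.≤-trans (h n (ℕₚ.m⊔n≤o⇒m≤o M N p))
    (ℚₚ.≤-trans (ℚₚ.+-monoˡ-≤ (½ ℚ.* ε) (k n (ℕₚ.m⊔n≤o⇒n≤o M N p)))
      (ℚₚ.≤-reflexive (trans (ℚₚ.+-assoc (seq t n) (½ ℚ.* ε) (½ ℚ.* ε))
        (cong (seq t n ℚ.+_) (halves ε)))))

functional≥0 : ∀ {x y} → Near x y → (A : Admissible 2 x y) → 0ℝ ≤ Admissible.functional A
functional≥0 {x} {y} near A ε 0<ε =
  let (M , h) = Sgn-eventually sgn
                  (≃-trans {∣ f y - f x ∣} {∣∇⟨ 2 ⟩ f ∣ x} {1ℝ} attains unit)
      (N , k) = attains ε/6 0<ε/6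
  in M ℕ.⊔ N , λ n p →
    let (∣σ∣≡1 , ∣r∣≡rσ) = h n (ℕₚ.m⊔n≤o⇒m≤o M N p)
        fₙ = λ v → seq (f v) n
        Gₙ = λ v → seq (∣∇⟨ 2 ⟩ f ∣ v) n
    in subst₂ (λ t η → 0ℚ ℚ.≤ t ℚ.+ η)
         (cong₂ ℚ._-_ (sym (seq-Δ ∣∇⟨ 2 ⟩ f ∣ x n))
           (cong (ℚ._* seq σ n) (cong₂ ℚ._-_ (sym (seq-Δ f y n)) (sym (seq-Δ f x n)))))
         (six ε)
         (Approximation.functional≥ fₙ Gₙ (seq σ n) ε/6 (ℚₚ.<⇒≤ 0<ε/6)
           (λ {v} {w} w∈ → *-sign-≤ (fₙ w ℚ.- fₙ v) ∣σ∣≡1 (gradient-bound 2 f n w∈))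
           (subst (λ t → Gₙ x ℚ.≤ t ℚ.+ ε/6) ∣r∣≡rσ
             (near⇒≥ ℚ.∣ fₙ y ℚ.- fₙ x ∣ (Gₙ x) (k n (ℕₚ.m⊔n≤o⇒n≤o M N p))))
           near)
  where
  open Admissible A
  -- Three directions with two errors each.
  ⅙ = ℤ.+ 1 ℚ./ 6
  ε/6 = ⅙ ℚ.* ε
  0<ε/6 : 0ℚ ℚ.< ε/6
  0<ε/6 = subst (ℚ._< ε/6) (ℚₚ.*-zeroʳ ⅙) (ℚₚ.*-monoʳ-<-pos ⅙ 0<ε)
  open +-*-Solver
  six : ∀ ε → Σ₃ (λ _ → ⅙ ℚ.* ε ℚ.+ ⅙ ℚ.* ε) ≡ ε
  six = solve 1 (λ ε → let η = con ⅙ :* ε :+ con ⅙ :* ε in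
    η :+ (η :+ (η :+ con 0ℚ)) := ε) refl

corollary1p13 : (x y : V) → Within 2 x y → ⌈ 0ℝ ⌉ ≤̄ K 2 x y
-- In terms of lower cuts, every rational `q` below 0 must bound each value of the functional from
-- below. The `_` is the sole index of the family defining `⌈ 0ℝ ⌉`.
corollary1p13 x y near q q≤0 A =
  ≤-trans {fromℚ q} {0ℝ} {Admissible.functional A} (q≤0 _)
    (functional≥0 (within⇒near near) A)
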